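{- For $n>3$, the centralizer of the pure cactus group $PJ_n$ in the cactus group $J_n$ is trivial.
   Context: For $n \ge 2$, the cactus group $J_n$ is the group with generators $s_{p,q}$ for $1 \le p < q \le n$ and relations: (j1) $s_{p,q}^2 = 1$; (j2) $s_{p,q}s_{m,r} = s_{m,r}s_{p,q}$ whenever $[p,q]\cap[m,r]=\emptyset$; (j3) $s_{p,q}s_{m,r} = s_{p+q-r,\,p+q-m}\,s_{p,q}$ whenever $[m,r]\subset[p,q]$. There is a homomorphism $s\colon J_n\to S_n$ sending $s_{p,q}$ to the permutation of $\{1,\dots,n\}$ that reverses the order of $p,p+1,\dots,q$ and fixes all other elements. The pure cactus group $PJ_n$ is the kernel of $s$. -}

module Defs where

-- The cactus group J_n as a group presentation, and the map s : J_n → S_n.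
-- Positions 1..n of the paper are encoded 0-indexed as 0..n-1.

open import Data.Nat using (ℕ; _+_; _∸_; _≤_; _<_; _≤ᵇ_)
open import Data.Bool using (Bool; true; false; not; if_then_else_; _∧_)
open import Data.List using (List; []; _∷_; _++_; foldr)
open import Data.Product using (_×_; _,_)
open import Data.Sum using (_⊎_)
open import Relation.Binary.PropositionalEquality using (_≡_)

record Gen (n : ℕ) : Set where
  constructor gen
  field
    p   : ℕ
    q   : ℕ
    p<q : p < q
    q<n : q < n
open Gen public

-- Letters of the free group on the generators: (g , true) = g, (g , false) = g⁻¹.
Letter : ℕ → Set
Letter n = Gen n × Bool

Word : ℕ → Set
Word n = List (Letter n)

⟨_⟩ : ∀ {n} → Gen n → Letter n
⟨ g ⟩ = g , true

infix 4 _≈_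
data _≈_ {n : ℕ} : Word n → Word n → Set where
  ≈-refl  : ∀ {u} → u ≈ u
  ≈-sym   : ∀ {u v} → u ≈ v → v ≈ u
  ≈-trans : ∀ {u v w} → u ≈ v → v ≈ w → u ≈ w
  ≈-cong  : ∀ {u u' v v'} → u ≈ u' → v ≈ v' → u ++ v ≈ u' ++ v'
  free    : ∀ (g : Gen n) (b : Bool) → (g , b) ∷ (g , not b) ∷ [] ≈ []
  j1      : ∀ (g : Gen n) → ⟨ g ⟩ ∷ ⟨ g ⟩ ∷ [] ≈ []
  j2      : ∀ (g h : Gen n) → (q g < p h ⊎ q h < p g) →
            ⟨ g ⟩ ∷ ⟨ h ⟩ ∷ [] ≈ ⟨ h ⟩ ∷ ⟨ g ⟩ ∷ []
  j3      : ∀ (g h h' : Gen n) → p g ≤ p h → q h ≤ q g →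
            p h' ≡ p g + q g ∸ q h → q h' ≡ p g + q g ∸ p h →
            ⟨ g ⟩ ∷ ⟨ h ⟩ ∷ [] ≈ ⟨ h' ⟩ ∷ ⟨ g ⟩ ∷ []

rev : ℕ → ℕ → ℕ → ℕ
rev a b i = if (a ≤ᵇ i) ∧ (i ≤ᵇ b) then a + b ∸ i else i

-- Image of a word under s : J_n → S_n (as a function on positions;
-- each s_{p,q} maps to an involution, so g and g⁻¹ have the same image).
perm : ∀ {n} → Word n → ℕ → ℕ
perm []              i = i
perm ((g , _) ∷ w) i = rev (p g) (q g) (perm w i)

Pure : ∀ {n} → Word n → Set
Pure {n} w = ∀ i → i < n → perm w i ≡ i

{-# OPTIONS --safe #-}

-- Let W be the right-angled Coxeter group generated by the subsets of {1,…,n},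
-- where two generators commute unless the subsets cross (they meet and neither
-- contains the other).  Sending s_{p,q} to the generator [p,q] followed by the
-- reversal of [p,q] maps J_n to W ⋊ S_n, and every commutation or cancellation
-- in the W-component of a word lifts to J_n.  So each element of J_n is given by
-- a word with reduced W-component, and reduced words are unique up to commutation.
-- If a reduced w has a first letter S ≠ [1,n], take a pure word x whose
-- consecutive letters cross and whose two ends both cross S; inside a block of
-- four consecutive positions such words are explicit.  Then xw is reduced and
-- has a first letter crossing S.  If wx = xw, then wx is reduced as well, by
-- length, and it still has S as a first letter; but first letters of one element
-- commute.  The only other case, w = s_{1,n}, is excluded in the same way by
-- conjugating such an x with s_{1,n-1}.
module Submission where

open import Defs
open import Data.Nat using (ℕ; zero; suc; _+_; _∸_; _≤_; _<_; _≤ᵇ_; z≤n; s≤s; z<s; _≤?_; _<?_)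
open import Data.Nat.Properties
open import Data.Nat.Tactic.RingSolver using (solve-∀)
open import Data.Bool using (Bool; true; false; _∧_; T)
import Data.Bool.Properties as Bool
open import Data.Unit using (tt)
open import Data.Empty using (⊥; ⊥-elim)
open import Data.Fin using (Fin; toℕ; fromℕ<)
import Data.Fin.Properties as Fin
open import Data.Vec using (Vec; lookup; tabulate)
import Data.Vec.Properties as Vec
open import Data.List using (List; []; _∷_; _++_; map; foldr; length)
import Data.List.Properties as List
open import Data.Product using (_×_; _,_; proj₁; proj₂; ∃; swap)
open import Data.Sum using (_⊎_; inj₁; inj₂; [_,_]′)
open import Function using (_∘_)
open import Relation.Nullary using (¬_; Dec; yes; no; contradiction)
open import Relation.Nullary.Decidable using (_×-dec_; _⊎-dec_; map′; True; toWitness)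
open import Relation.Binary using (DecidableEquality)
open import Relation.Binary.PropositionalEquality using (_≡_; _≢_; refl; sym; trans; cong; cong₂; subst; subst₂; module ≡-Reasoning)

-- Right-angled Coxeter groups

module RightAngled {L : Set} (_≟_ : DecidableEquality L) (_#_ : L → L → Set)
                   (#-sym : ∀ {s t} → s # t → t # s) (_#?_ : ∀ s t → Dec (s # t)) where

  -- Rem s w v: the letter s can be commuted to the front of w, leaving v.
  data Rem (s : L) : List L → List L → Set where
    here  : ∀ {w} → Rem s (s ∷ w) w
    there : ∀ {t w v} → s ≢ t → ¬ s # t → Rem s w v → Rem s (t ∷ w) (t ∷ v)

  First : L → List L → Set
  First s w = ∃ (Rem s w)

  first? : ∀ s w → Dec (First s w)
  first? s [] = no λ ()
  first? s (t ∷ w) with s ≟ t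
  ... | yes refl = yes (w , here)
  ... | no s≢t with s #? t
  ...   | yes s#t = no λ { (_ , here) → s≢t refl ; (_ , there _ c _) → c s#t }
  ...   | no ¬s#t = map′ (λ (v , r) → t ∷ v , there s≢t ¬s#t r)
                         (λ { (_ , here) → contradiction refl s≢t ; (_ , there _ _ r) → _ , r })
                         (first? s w)

  First-∷⁻ : ∀ {s t w} → First s (t ∷ w) → s ≡ t ⊎ First s w
  First-∷⁻ (_ , here) = inj₁ refl
  First-∷⁻ (_ , there _ _ r) = inj₂ (_ , r)

  Rem-functional : ∀ {s w v v'} → Rem s w v → Rem s w v' → v ≡ v'
  Rem-functional here here = refl
  Rem-functional here (there s≢s _ _) = contradiction refl s≢s
  Rem-functional (there s≢s _ _) here = contradiction refl s≢s
  Rem-functional (there _ _ r) (there _ _ r') = cong (_ ∷_) (Rem-functional r r')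

  Rem-++ : ∀ {s w v} z → Rem s w v → Rem s (w ++ z) (v ++ z)
  Rem-++ z here = here
  Rem-++ z (there s≢t c r) = there s≢t c (Rem-++ z r)

  firsts-commute : ∀ {s t w} → First s w → First t w → s ≢ t → ¬ s # t
  firsts-commute (_ , here) (_ , here) s≢t = contradiction refl s≢t
  firsts-commute (_ , here) (_ , there _ c _) _ = c ∘ #-sym
  firsts-commute (_ , there _ c _) (_ , here) _ = c
  firsts-commute (_ , there _ _ r) (_ , there _ _ r') = firsts-commute (_ , r) (_ , r')

  -- Neither removal touches the letter that the other one takes out, so the order is immaterial.
  -- This is the confluence behind `push-comm`.
  Rem-diamond : ∀ {s t w v u} → s ≢ t → Rem s w v → Rem t w u → ∃ λ z → Rem t v z × Rem s u z
  Rem-diamond s≢t here here = contradiction refl s≢t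
  Rem-diamond s≢t here (there _ _ r) = _ , r , here
  Rem-diamond s≢t (there _ _ r) here = _ , here , r
  Rem-diamond s≢t (there a b r) (there c d r') with Rem-diamond s≢t r r'
  ... | z , r₁ , r₂ = _ , there c d r₁ , there a b r₂

  -- Putting `s` back cannot block `t`, because the two commute.
  Rem-Rem : ∀ {s t w v z} → s ≢ t → ¬ s # t → Rem s w v → Rem t v z → First t w
  Rem-Rem s≢t c here r = _ , there (s≢t ∘ sym) (c ∘ #-sym) r
  Rem-Rem s≢t c (there _ _ r) here = _ , here
  Rem-Rem s≢t c (there _ _ r) (there d e r') with Rem-Rem s≢t c r r'
  ... | _ , r″ = _ , there d e r″

  infix 4 _∼_
  data _∼_ : List L → List L → Set where
    ∼-refl  : ∀ {w} → w ∼ w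
    ∼-trans : ∀ {u v w} → u ∼ v → v ∼ w → u ∼ w
    prep    : ∀ {s w v} → w ∼ v → s ∷ w ∼ s ∷ v
    swap∼   : ∀ {s t w} → ¬ s # t → s ∷ t ∷ w ∼ t ∷ s ∷ w

  ∼-sym : ∀ {w v} → w ∼ v → v ∼ w
  ∼-sym ∼-refl = ∼-refl
  ∼-sym (∼-trans e f) = ∼-trans (∼-sym f) (∼-sym e)
  ∼-sym (prep e) = prep (∼-sym e)
  ∼-sym (swap∼ c) = swap∼ (c ∘ #-sym)

  ∼-reflexive : ∀ {w v} → w ≡ v → w ∼ v
  ∼-reflexive refl = ∼-refl

  ∼-length : ∀ {w v} → w ∼ v → length w ≡ length v
  ∼-length ∼-refl = refl
  ∼-length (∼-trans e f) = trans (∼-length e) (∼-length f)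
  ∼-length (prep e) = cong suc (∼-length e)
  ∼-length (swap∼ _) = refl

  Rem⇒∼ : ∀ {s w v} → Rem s w v → w ∼ s ∷ v
  Rem⇒∼ here = ∼-refl
  Rem⇒∼ (there _ c r) = ∼-trans (prep (Rem⇒∼ r)) (swap∼ (c ∘ #-sym))

  Rem-∼ : ∀ {s w w' v} → w ∼ w' → Rem s w v → ∃ λ v' → Rem s w' v' × v ∼ v'
  Rem-∼ ∼-refl r = _ , r , ∼-refl
  Rem-∼ (∼-trans e f) r with Rem-∼ e r
  ... | _ , r' , e' with Rem-∼ f r'
  ...   | _ , r″ , f' = _ , r″ , ∼-trans e' f'
  Rem-∼ (prep e) here = _ , here , e
  Rem-∼ (prep e) (there a b r) with Rem-∼ e r
  ... | _ , r' , e' = _ , there a b r' , prep e'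
  Rem-∼ (swap∼ {s} {t} c) here with s ≟ t
  ... | yes refl = _ , here , ∼-refl
  ... | no s≢t = _ , there s≢t c here , ∼-refl
  Rem-∼ (swap∼ c) (there a b here) = _ , here , ∼-refl
  Rem-∼ (swap∼ c) (there a b (there a' b' r)) = _ , there a' b' (there a b r) , swap∼ c

  First-∼ : ∀ {s w w'} → w ∼ w' → First s w → First s w'
  First-∼ e (_ , r) = _ , proj₁ (proj₂ (Rem-∼ e r))

  -- Reduced words and left multiplication

  data Reduced : List L → Set where
    []  : Reduced []
    _∷_ : ∀ {s w} → ¬ First s w → Reduced w → Reduced (s ∷ w)

  Reduced-∼ : ∀ {w w'} → w ∼ w' → Reduced w → Reduced w'
  Reduced-∼ ∼-refl ρ = ρ
  Reduced-∼ (∼-trans e f) ρ = Reduced-∼ f (Reduced-∼ e ρ)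
  Reduced-∼ (prep e) (ν ∷ ρ) = (ν ∘ First-∼ (∼-sym e)) ∷ Reduced-∼ e ρ
  Reduced-∼ (swap∼ {s} {t} {w} c) (νs ∷ νt ∷ ρ) = νt' ∷ νs' ∷ ρ
    where
    νt' : ¬ First t (s ∷ w)
    νt' (_ , here) = νs (_ , here)
    νt' (_ , there _ _ r) = νt (_ , r)
    νs' : ¬ First s w
    νs' (_ , r) with s ≟ t
    ... | yes refl = νt (_ , r)
    ... | no s≢t = νs (_ , there s≢t c r)

  Reduced-Rem : ∀ {s w v} → Reduced w → Rem s w v → Reduced (s ∷ v)
  Reduced-Rem ρ r = Reduced-∼ (Rem⇒∼ r) ρ

  Reduced-tail : ∀ {s w} → Reduced (s ∷ w) → Reduced w
  Reduced-tail (_ ∷ ρ) = ρ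

  -- Left multiplication by the generator `s`, in the style of van der Waerden: letting generators
  -- act on reduced words up to `∼` yields uniqueness of reduced words without a study of rewriting
  -- sequences.
  push : L → List L → List L
  push s w with first? s w
  ... | yes (v , _) = v
  ... | no _ = s ∷ w

  push-cancel : ∀ {s w v} → Rem s w v → push s w ≡ v
  push-cancel {s} {w} r with first? s w
  ... | yes (_ , r') = Rem-functional r' r
  ... | no ν = contradiction (_ , r) ν

  push-grow : ∀ {s w} → ¬ First s w → push s w ≡ s ∷ w
  push-grow {s} {w} ν with first? s w
  ... | yes f = contradiction f ν
  ... | no _ = refl

  push-Reduced : ∀ {s w} → Reduced w → Reduced (push s w)
  push-Reduced {s} {w} ρ with first? s w
  ... | yes (_ , r) = Reduced-tail (Reduced-Rem ρ r)
  ... | no ν = ν ∷ ρ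

  push-∼ : ∀ {s w w'} → w ∼ w' → push s w ∼ push s w'
  push-∼ {s} {w} e with first? s w
  ... | no ν = ∼-trans (prep e) (∼-reflexive (sym (push-grow (ν ∘ First-∼ (∼-sym e)))))
  ... | yes (_ , r) with Rem-∼ e r
  ...   | _ , r' , e' = ∼-trans e' (∼-reflexive (sym (push-cancel r')))

  push-involutive : ∀ {s w} → Reduced w → push s (push s w) ∼ w
  push-involutive {s} {w} ρ with first? s w
  ... | no ν = ∼-reflexive (push-cancel here)
  ... | yes (v , r) with Reduced-Rem ρ r
  ...   | ν ∷ _ = ∼-trans (∼-reflexive (push-grow ν)) (∼-sym (Rem⇒∼ r))

  -- The cases are whether `s` and `t` cancel in `w`. By `Rem-diamond` and `Rem-Rem`, whether one of
  -- them cancels does not depend on the other having been multiplied first.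
  push-comm : ∀ {s t} w → ¬ s # t → push s (push t w) ∼ push t (push s w)
  push-comm {s} {t} w c with s ≟ t
  ... | yes refl = ∼-refl
  ... | no s≢t with first? s w | first? t w
  ...   | yes (_ , r) | yes (_ , r') =
            let _ , r₁ , r₂ = Rem-diamond s≢t r r'
            in ∼-reflexive (trans (push-cancel r₂) (sym (push-cancel r₁)))
  ...   | yes (_ , r) | no ν =
            ∼-reflexive (trans (push-cancel (there s≢t c r))
                               (sym (push-grow (ν ∘ Rem-Rem s≢t c r ∘ proj₂))))
  ...   | no ν | yes (_ , r) =
            ∼-reflexive (trans (push-grow (ν ∘ Rem-Rem (s≢t ∘ sym) (c ∘ #-sym) r ∘ proj₂))
                               (sym (push-cancel (there (s≢t ∘ sym) (c ∘ #-sym) r))))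
  ...   | no ν | no ν' =
            ∼-trans (∼-reflexive (push-grow λ { (_ , here) → s≢t refl ; (_ , there _ _ r) → ν (_ , r) }))
           (∼-trans (swap∼ c)
                    (∼-reflexive (sym (push-grow λ { (_ , here) → s≢t refl ; (_ , there _ _ r) → ν' (_ , r) }))))

  nf : List L → List L
  nf = foldr push []

  Reduced⇒nf≡ : ∀ {w} → Reduced w → nf w ≡ w
  Reduced⇒nf≡ [] = refl
  Reduced⇒nf≡ {s ∷ w} (ν ∷ ρ) = trans (cong (push s) (Reduced⇒nf≡ ρ)) (push-grow ν)

  push-length : ∀ s w → length (push s w) ≤ suc (length w)
  push-length s w with first? s w
  ... | yes (_ , r) = m≤n⇒m≤1+n (≤-trans (n≤1+n _) (≤-reflexive (sym (∼-length (Rem⇒∼ r)))))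
  ... | no _ = ≤-refl

  nf-length : ∀ w → length (nf w) ≤ length w
  nf-length [] = z≤n
  nf-length (s ∷ w) = ≤-trans (push-length s (nf w)) (s≤s (nf-length w))

  -- A single cancellation loses length for good, since every further letter lengthens the normal
  -- form by at most one.
  nf-length⇒Reduced : ∀ w → length (nf w) ≡ length w → Reduced w
  nf-length⇒Reduced [] _ = []
  nf-length⇒Reduced (s ∷ w) eq with first? s (nf w)
  ... | yes (v , r) = contradiction
          (≤-trans (s≤s (≤-trans (≤-reflexive (sym (∼-length (Rem⇒∼ r)))) (nf-length w))) (≤-reflexive (sym eq)))
          (<-asym (n<1+n (length v)))
  ... | no ν = subst (λ u → ¬ First s u) (Reduced⇒nf≡ ρ) ν ∷ ρ
    where
    ρ : Reduced w
    ρ = nf-length⇒Reduced w (suc-injective eq)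

  -- Involutions suffice, as each generator of the cactus group acts on the letters by one;
  -- injectivity and reflection of crossings then come for free.
  record Symmetry : Set where
    field
      fun        : L → L
      involutive : ∀ s → fun (fun s) ≡ s
      preserves  : ∀ {s t} → s # t → fun s # fun t

    reflects : ∀ {s t} → fun s # fun t → s # t
    reflects = subst₂ _#_ (involutive _) (involutive _) ∘ preserves

    injective : ∀ {s t} → fun s ≡ fun t → s ≡ t
    injective eq = trans (sym (involutive _)) (trans (cong fun eq) (involutive _))

    map-involutive : ∀ w → map fun (map fun w) ≡ w
    map-involutive w = trans (sym (List.map-∘ w)) (trans (List.map-cong involutive w) (List.map-id w))

    Rem-map : ∀ {s w v} → Rem s w v → Rem (fun s) (map fun w) (map fun v)
    Rem-map here = here
    Rem-map (there a b r) = there (a ∘ injective) (b ∘ reflects) (Rem-map r)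

    Rem-map⁻ : ∀ {s w v} → Rem s (map fun w) v → Rem (fun s) w (map fun v)
    Rem-map⁻ {w = w} r = subst (λ u → Rem _ u _) (map-involutive w) (Rem-map r)

    First-map⁻ : ∀ {s w} → First (fun s) (map fun w) → First s w
    First-map⁻ {s} {w} (_ , r) = subst (λ t → First t w) (involutive s) (_ , Rem-map⁻ r)

    ∼-map : ∀ {w v} → w ∼ v → map fun w ∼ map fun v
    ∼-map ∼-refl = ∼-refl
    ∼-map (∼-trans e f) = ∼-trans (∼-map e) (∼-map f)
    ∼-map (prep e) = prep (∼-map e)
    ∼-map (swap∼ c) = swap∼ (c ∘ reflects)

    Reduced-map : ∀ {w} → Reduced w → Reduced (map fun w)
    Reduced-map [] = []
    Reduced-map (ν ∷ ρ) = (ν ∘ First-map⁻) ∷ Reduced-map ρ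

    push-map : ∀ s w → map fun (push s w) ≡ push (fun s) (map fun w)
    push-map s w with first? s w
    ... | yes (_ , r) = sym (push-cancel (Rem-map r))
    ... | no ν = sym (push-grow (ν ∘ First-map⁻))

    nf-map : ∀ w → map fun (nf w) ≡ nf (map fun w)
    nf-map [] = refl
    nf-map (s ∷ w) = trans (push-map s (nf w)) (cong (push (fun s)) (nf-map w))

-- Reflections of intervals

In : ℕ → ℕ → ℕ → Set
In a b i = a ≤ i × i ≤ b

inside : ℕ → ℕ → ℕ → Bool
inside a b i = (a ≤ᵇ i) ∧ (i ≤ᵇ b)

T⇒≡true : ∀ {x} → T x → x ≡ true
T⇒≡true {true} _ = refl

In⇒inside : ∀ {a b i} → In a b i → inside a b i ≡ true
In⇒inside (a≤i , i≤b) = cong₂ _∧_ (T⇒≡true (≤⇒≤ᵇ a≤i)) (T⇒≡true (≤⇒≤ᵇ i≤b))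

inside⇒In : ∀ {a b i} → inside a b i ≡ true → In a b i
inside⇒In {a} {b} {i} eq with a ≤ᵇ i in e₁ | i ≤ᵇ b in e₂
... | true | true = ≤ᵇ⇒≤ a i (subst T (sym e₁) tt) , ≤ᵇ⇒≤ i b (subst T (sym e₂) tt)

≢true⇒≡false : ∀ {x} → x ≢ true → x ≡ false
≢true⇒≡false {true} x≢true = contradiction refl x≢true
≢true⇒≡false {false} _ = refl

true≢false : ∀ {x} → x ≡ true → x ≢ false
true≢false refl ()

¬In⇒outside : ∀ {a b i} → ¬ In a b i → inside a b i ≡ false
¬In⇒outside ¬in = ≢true⇒≡false (¬in ∘ inside⇒In)

inside-cong : ∀ {a b i a' b' i'} → (In a b i → In a' b' i') → (In a' b' i' → In a b i) →
              inside a b i ≡ inside a' b' i'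
inside-cong {a} {b} {i} f g with inside a b i in eq
... | true = sym (In⇒inside (f (inside⇒In eq)))
... | false = sym (¬In⇒outside λ q → true≢false (In⇒inside (g q)) eq)

-- The reflected point is described by the sum `i + j ≡ a + b`, which keeps truncated subtraction
-- out of the later arguments.
data RevView (a b i : ℕ) : ℕ → Set where
  inner : ∀ {j} → In a b i → i + j ≡ a + b → RevView a b i j
  outer : ¬ In a b i → RevView a b i i

rev-view : ∀ a b i → RevView a b i (rev a b i)
rev-view a b i with inside a b i in eq
... | true = inner (inside⇒In eq) (m+[n∸m]≡n (≤-trans (proj₂ (inside⇒In {a} eq)) (m≤n+m b a)))
... | false = outer λ q → true≢false (In⇒inside q) eq

RevView-functional : ∀ {a b i j k} → RevView a b i j → RevView a b i k → j ≡ k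
RevView-functional {i = i} (inner _ e) (inner _ e') = +-cancelˡ-≡ i _ _ (trans e (sym e'))
RevView-functional (inner q _) (outer ¬q) = contradiction q ¬q
RevView-functional (outer ¬q) (inner q _) = contradiction q ¬q
RevView-functional (outer _) (outer _) = refl

rev≡ : ∀ {a b i j} → RevView a b i j → rev a b i ≡ j
rev≡ = RevView-functional (rev-view _ _ _)

rev-outer : ∀ {a b i} → ¬ In a b i → rev a b i ≡ i
rev-outer = rev≡ ∘ outer

complement-≤ : ∀ {a b c d} → a + b ≡ c + d → a ≤ c → d ≤ b
complement-≤ {a} {b} {c} {d} eq a≤c =
  +-cancelˡ-≤ a d b (≤-trans (+-monoˡ-≤ d a≤c) (≤-reflexive (sym eq)))

complement-In : ∀ {a b i j} → i + j ≡ a + b → In a b i → In a b j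
complement-In {a} {b} eq (a≤i , i≤b) =
  complement-≤ (trans eq (+-comm a b)) i≤b , complement-≤ (sym eq) a≤i

rev-In : ∀ {a b i} → In a b i → In a b (rev a b i)
rev-In {a} {b} {i} q with rev a b i | rev-view a b i
... | _ | inner _ eq = complement-In eq q
... | _ | outer _ = q

rev-involutive : ∀ a b i → rev a b (rev a b i) ≡ i
rev-involutive a b i with rev a b i | rev-view a b i
... | j | inner q eq = rev≡ (inner (complement-In eq q) (trans (+-comm j i) eq))
... | _ | outer ¬q = rev-outer ¬q

rev-In⁻ : ∀ {a b i} → In a b (rev a b i) → In a b i
rev-In⁻ {a} {b} {i} q = subst (In a b) (rev-involutive a b i) (rev-In q)

rev-< : ∀ {a b i n} → b < n → i < n → rev a b i < n
rev-< {a} {b} {i} b<n i<n with rev a b i | rev-view a b i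
... | _ | inner q eq = ≤-<-trans (proj₂ (complement-In eq q)) b<n
... | _ | outer _ = i<n

-- Reflection in `[a,b]` exchanges the ends of a subinterval: `c'` is the image of `d` and `d'` the
-- image of `c`. This is the situation of `j3`.
module Mirror {a b c d c' d'} (a≤c : a ≤ c) (d≤b : d ≤ b)
              (c'+d : c' + d ≡ a + b) (d'+c : d' + c ≡ a + b) where

  mirror-⊆ : ∀ {i} → In c' d' i → In a b i
  mirror-⊆ (c'≤i , i≤d') =
    ≤-trans (complement-≤ (trans (+-comm d c') (trans c'+d (+-comm a b))) d≤b) c'≤i ,
    ≤-trans i≤d' (complement-≤ (trans (sym d'+c) (+-comm d' c)) a≤c)

  mirror-In : ∀ {i} → In c' d' i → In c d (rev a b i)
  mirror-In {i} q@(c'≤i , i≤d') with rev a b i | rev-view a b i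
  ... | _ | inner _ eq = complement-≤ (trans eq (sym d'+c)) i≤d' , complement-≤ (trans c'+d (sym eq)) c'≤i
  ... | _ | outer ¬q = contradiction (mirror-⊆ q) ¬q

  mirror-In⁻ : ∀ {i} → In c d (rev a b i) → In c' d' i
  mirror-In⁻ {i} (c≤j , j≤d) with rev a b i | rev-view a b i
  ... | j | inner _ eq =
          complement-≤ (trans (+-comm j i) (trans eq (trans (sym c'+d) (+-comm c' d)))) j≤d ,
          complement-≤ (trans (+-comm c d') (trans d'+c (trans (sym eq) (+-comm i j)))) c≤j
  ... | _ | outer ¬q = contradiction (≤-trans a≤c c≤j , ≤-trans j≤d d≤b) ¬q

  mirror-rev : ∀ i → rev c d (rev a b i) ≡ rev a b (rev c' d' i)
  mirror-rev i with rev c' d' i | rev-view c' d' i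
  ... | _ | outer ¬q = rev-outer (¬q ∘ mirror-In⁻)
  ... | k | inner q i+k with rev a b i | rev-view a b i | mirror-In q
  ...   | _ | outer ¬q | _ = contradiction (mirror-⊆ q) ¬q
  ...   | j | inner _ i+j | j∈ with rev a b k | rev-view a b k
  ...     | _ | outer ¬q = contradiction (mirror-⊆ (complement-In i+k q)) ¬q
  -- It remains to see `j + l ≡ c + d`. Adding `i + k` to both sides lets the four known sums be
  -- regrouped.
  ...     | l | inner _ k+l = rev≡ (inner j∈ (+-cancelˡ-≡ (i + k) _ _ lemma))
    where
    open ≡-Reasoning
    regroup : ∀ i j k l → (i + k) + (j + l) ≡ (i + j) + (k + l)
    regroup = solve-∀
    regroup' : ∀ c d c' d' → (c' + d) + (d' + c) ≡ (c' + d') + (c + d)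
    regroup' = solve-∀
    lemma : (i + k) + (j + l) ≡ (i + k) + (c + d)
    lemma = begin
      (i + k) + (j + l)     ≡⟨ regroup i j k l ⟩
      (i + j) + (k + l)     ≡⟨ cong₂ _+_ (trans i+j (sym c'+d)) (trans k+l (sym d'+c)) ⟩
      (c' + d) + (d' + c)   ≡⟨ regroup' c d c' d' ⟩
      (c' + d') + (c + d)   ≡⟨ cong (_+ (c + d)) (sym i+k) ⟩
      (i + k) + (c + d)     ∎

rev-shift : ∀ k a b i → rev (k + a) (k + b) (k + i) ≡ k + rev a b i
rev-shift k a b i with rev a b i | rev-view a b i
... | j | inner (a≤i , i≤b) eq =
        rev≡ (inner (+-monoʳ-≤ k a≤i , +-monoʳ-≤ k i≤b)
                    (trans (regroup k i j) (trans (cong ((k + k) +_) eq) (sym (regroup k a b)))))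
  where
  regroup : ∀ k x y → (k + x) + (k + y) ≡ (k + k) + (x + y)
  regroup = solve-∀
... | _ | outer ¬q = rev-outer λ (x , y) → ¬q (+-cancelˡ-≤ k _ _ x , +-cancelˡ-≤ k _ _ y)

-- Crossing subsets

module _ {n : ℕ} where

  -- Letters are arbitrary subsets, since reversals carry intervals to subsets that need not be
  -- intervals. Boolean vectors make equality and crossing decidable.
  Meets Exceeds : Vec Bool n → Vec Bool n → Set
  Meets s t = ∃ λ i → lookup s i ≡ true × lookup t i ≡ true
  Exceeds s t = ∃ λ i → lookup s i ≡ true × lookup t i ≡ false

  infix 4 _#_
  record _#_ (s t : Vec Bool n) : Set where
    constructor crossing
    field
      meets    : Meets s t
      exceedsˡ : Exceeds s t
      exceedsʳ : Exceeds t s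

  #-sym : ∀ {s t} → s # t → t # s
  #-sym (crossing (i , m) e e') = crossing (i , swap m) e' e

  #-irrefl : ∀ {s} → ¬ s # s
  #-irrefl (crossing _ (_ , e , e') _) = true≢false e e'

  _#?_ : ∀ s t → Dec (s # t)
  s #? t = map′ (λ (m , e , e') → crossing m e e') (λ (crossing m e e') → m , e , e')
    (      Fin.any? (λ i → (lookup s i Bool.≟ true) ×-dec (lookup t i Bool.≟ true))
     ×-dec Fin.any? (λ i → (lookup s i Bool.≟ true) ×-dec (lookup t i Bool.≟ false))
     ×-dec Fin.any? (λ i → (lookup t i Bool.≟ true) ×-dec (lookup s i Bool.≟ false)))

  open RightAngled (Vec.≡-dec Bool._≟_) _#_ #-sym _#?_ public

  Vec-ext : ∀ {s t : Vec Bool n} → (∀ i → lookup s i ≡ lookup t i) → s ≡ t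
  Vec-ext {s} {t} eq = trans (sym (Vec.tabulate∘lookup s)) (trans (Vec.tabulate-cong eq) (Vec.tabulate∘lookup t))

  -- Intervals as subsets, moved by the reversals

  revFin : Gen n → Fin n → Fin n
  revFin g i = fromℕ< (rev-< {p g} (q<n g) (Fin.toℕ<n i))

  toℕ-revFin : ∀ g i → toℕ (revFin g i) ≡ rev (p g) (q g) (toℕ i)
  toℕ-revFin g i = Fin.toℕ-fromℕ< _

  toℕ-revFin₂ : ∀ g h i → toℕ (revFin g (revFin h i)) ≡ rev (p g) (q g) (rev (p h) (q h) (toℕ i))
  toℕ-revFin₂ g h i = trans (toℕ-revFin g _) (cong (rev (p g) (q g)) (toℕ-revFin h i))

  ι : Gen n → Vec Bool n
  ι g = tabulate λ i → inside (p g) (q g) (toℕ i)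

  -- The preimage under the reversal is also the image, the reversal being an involution.
  σ : Gen n → Vec Bool n → Vec Bool n
  σ g s = tabulate λ i → lookup s (revFin g i)

  lookup-ι : ∀ g i → lookup (ι g) i ≡ inside (p g) (q g) (toℕ i)
  lookup-ι g = Vec.lookup∘tabulate _

  lookup-σ : ∀ g s i → lookup (σ g s) i ≡ lookup s (revFin g i)
  lookup-σ g s = Vec.lookup∘tabulate _

  lookup-σσ : ∀ g h s i → lookup (σ g (σ h s)) i ≡ lookup s (revFin h (revFin g i))
  lookup-σσ g h s i = trans (lookup-σ g (σ h s) i) (lookup-σ h s _)

  lookup-σι : ∀ g h i → lookup (σ g (ι h)) i ≡ inside (p h) (q h) (rev (p g) (q g) (toℕ i))
  lookup-σι g h i = trans (lookup-σ g (ι h) i) (trans (lookup-ι h _) (cong (inside (p h) (q h)) (toℕ-revFin g i)))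

  ∈ι : ∀ {g i} → lookup (ι g) i ≡ true → In (p g) (q g) (toℕ i)
  ∈ι {g} eq = inside⇒In (trans (sym (lookup-ι g _)) eq)

  ∉ι : ∀ {g i} → lookup (ι g) i ≡ false → ¬ In (p g) (q g) (toℕ i)
  ∉ι {g} eq q = true≢false (trans (lookup-ι g _) (In⇒inside q)) eq

  ι∋ : ∀ g {k} (k<n : k < n) → In (p g) (q g) k → lookup (ι g) (fromℕ< k<n) ≡ true
  ι∋ g k<n q = trans (lookup-ι g _) (In⇒inside (subst (In _ _) (sym (Fin.toℕ-fromℕ< k<n)) q))

  ι∌ : ∀ g {k} (k<n : k < n) → ¬ In (p g) (q g) k → lookup (ι g) (fromℕ< k<n) ≡ false
  ι∌ g k<n ¬q = trans (lookup-ι g _) (¬In⇒outside (¬q ∘ subst (In _ _) (Fin.toℕ-fromℕ< k<n)))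

  σι≡ι : ∀ g h h' → (∀ i → inside (p h) (q h) (rev (p g) (q g) i) ≡ inside (p h') (q h') i) → σ g (ι h) ≡ ι h'
  σι≡ι g h h' eq = Vec-ext λ i → trans (lookup-σι g h i) (trans (eq (toℕ i)) (sym (lookup-ι h' i)))

  σι≡ι-self : ∀ g → σ g (ι g) ≡ ι g
  σι≡ι-self g = σι≡ι g g g λ i → inside-cong {p g} {q g} {_} {p g} {q g} rev-In⁻ rev-In

  -- Taking preimages reverses composition, hence the order of the reversals in the hypothesis.
  σσ≡σσ : ∀ g h k l → (∀ i → rev (p h) (q h) (rev (p g) (q g) i) ≡ rev (p l) (q l) (rev (p k) (q k) i)) →
          ∀ s → σ g (σ h s) ≡ σ k (σ l s)
  σσ≡σσ g h k l eq s = Vec-ext λ i →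
    trans (lookup-σσ g h s i)
   (trans (cong (lookup s) (Fin.toℕ-injective (trans (toℕ-revFin₂ h g i) (trans (eq (toℕ i)) (sym (toℕ-revFin₂ l k i))))))
          (sym (lookup-σσ k l s i)))

  σ-involutive : ∀ g s → σ g (σ g s) ≡ s
  σ-involutive g s = Vec-ext λ i → trans (lookup-σσ g g s i)
    (cong (lookup s) (Fin.toℕ-injective (trans (toℕ-revFin₂ g g i) (rev-involutive (p g) (q g) (toℕ i)))))

  σ-transports : ∀ g {b} s i → lookup s i ≡ b → lookup (σ g s) (revFin g i) ≡ b
  σ-transports g s i eq = trans (sym (lookup-σ g (σ g s) i)) (trans (cong (λ t → lookup t i) (σ-involutive g s)) eq)

  σ-# : ∀ g {s t} → s # t → σ g s # σ g t
  σ-# g {s} {t} (crossing (i , a , b) (j , c , d) (k , e , f)) = crossing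
    (revFin g i , σ-transports g s i a , σ-transports g t i b)
    (revFin g j , σ-transports g s j c , σ-transports g t j d)
    (revFin g k , σ-transports g t k e , σ-transports g s k f)

  σ-symmetry : Gen n → Symmetry
  σ-symmetry g = record { fun = σ g ; involutive = σ-involutive g ; preserves = σ-# g }

  module Sym g = Symmetry (σ-symmetry g)

  Gen-≡ : ∀ {g h : Gen n} → p g ≡ p h → q g ≡ q h → g ≡ h
  Gen-≡ {gen a b _ _} {gen _ _ _ _} refl refl = cong₂ (gen a b) (≤-irrelevant _ _) (≤-irrelevant _ _)

  ι-⊆ : ∀ {g h} → ι g ≡ ι h → ∀ {k} → k < n → In (p g) (q g) k → In (p h) (q h) k
  ι-⊆ {g} {h} eq {k} k<n k∈g = subst (In _ _) (Fin.toℕ-fromℕ< k<n)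
    (∈ι {h} (subst (λ s → lookup s (fromℕ< k<n) ≡ true) eq (ι∋ g k<n k∈g)))

  -- For lifting cancellations: a letter that is an interval determines its generator.
  ι-injective : ∀ {g h} → ι g ≡ ι h → g ≡ h
  ι-injective {g} {h} eq = Gen-≡
    (≤-antisym (proj₁ (ends h g (sym eq))) (proj₁ (ends g h eq)))
    (≤-antisym (proj₂ (ends g h eq)) (proj₂ (ends h g (sym eq))))
    where
    ends : ∀ g h → ι g ≡ ι h → p h ≤ p g × q g ≤ q h
    ends g h eq = proj₁ (ι-⊆ {g} {h} eq (<-trans (p<q g) (q<n g)) (≤-refl , <⇒≤ (p<q g))) ,
                  proj₂ (ι-⊆ {g} {h} eq (q<n g) (<⇒≤ (p<q g) , ≤-refl))

  -- Relative position of intervals and the exchange relations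

  Overlaps Crosses Disjoint _⊑_ : Gen n → Gen n → Set
  Overlaps g h = p g < p h × p h ≤ q g × q g < q h
  Crosses g h = Overlaps g h ⊎ Overlaps h g
  Disjoint g h = q g < p h ⊎ q h < p g
  h ⊑ g = p g ≤ p h × q h ≤ q g

  Crosses-sym : ∀ g h → Crosses g h → Crosses h g
  Crosses-sym g h (inj₁ x) = inj₂ x
  Crosses-sym g h (inj₂ x) = inj₁ x

  Overlaps⇒# : ∀ g h → Overlaps g h → ι g # ι h
  Overlaps⇒# g h (a , b , c) = crossing
    (fromℕ< ph<n , ι∋ g ph<n (<⇒≤ a , b) , ι∋ h ph<n (≤-refl , <⇒≤ (p<q h)))
    (fromℕ< pg<n , ι∋ g pg<n (≤-refl , <⇒≤ (p<q g)) , ι∌ h pg<n (<⇒≱ a ∘ proj₁))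
    (fromℕ< (q<n h) , ι∋ h (q<n h) (<⇒≤ (p<q h) , ≤-refl) , ι∌ g (q<n h) (<⇒≱ c ∘ proj₂))
    where
    pg<n = <-trans (p<q g) (q<n g)
    ph<n = <-trans (p<q h) (q<n h)

  Crosses⇒# : ∀ g h → Crosses g h → ι g # ι h
  Crosses⇒# g h (inj₁ o) = Overlaps⇒# g h o
  Crosses⇒# g h (inj₂ o) = #-sym (Overlaps⇒# h g o)

  Disjoint⇒¬In : ∀ {g h} → Disjoint g h → ∀ {i} → In (p g) (q g) i → ¬ In (p h) (q h) i
  Disjoint⇒¬In (inj₁ d) (_ , a) (b , _) = <⇒≱ d (≤-trans b a)
  Disjoint⇒¬In (inj₂ d) (a , _) (_ , b) = <⇒≱ d (≤-trans a b)

  Disjoint⇒¬# : ∀ {g h} → Disjoint g h → ¬ ι g # ι h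
  Disjoint⇒¬# {g} {h} d (crossing (_ , a , b) _ _) = Disjoint⇒¬In {g} {h} d (∈ι {g} a) (∈ι {h} b)

  ⊑⇒¬# : ∀ {g h} → h ⊑ g → ¬ ι g # ι h
  ⊑⇒¬# {g} {h} (a , b) (crossing _ _ (_ , k∈h , k∉g)) =
    ∉ι {g} k∉g (≤-trans a (proj₁ (∈ι {h} k∈h)) , ≤-trans (proj₂ (∈ι {h} k∈h)) b)

  -- Intervals that do not cross are disjoint or nested, which are the situations of `j2` and `j3`.
  position : ∀ g h → Crosses g h ⊎ Disjoint g h ⊎ h ⊑ g ⊎ g ⊑ h
  position g h with q g <? p h | q h <? p g
  ... | yes d | _ = inj₂ (inj₁ (inj₁ d))
  ... | no _ | yes d = inj₂ (inj₁ (inj₂ d))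
  ... | no ¬d | no ¬d' with p g <? p h | p h <? p g | q h ≤? q g | q g ≤? q h
  ...   | yes a | _ | yes b | _ = inj₂ (inj₂ (inj₁ (<⇒≤ a , b)))
  ...   | yes a | _ | no ¬b | _ = inj₁ (inj₁ (a , ≮⇒≥ ¬d , ≰⇒> ¬b))
  ...   | no _ | yes a | _ | yes b = inj₂ (inj₂ (inj₂ (<⇒≤ a , b)))
  ...   | no _ | yes a | _ | no ¬b = inj₁ (inj₂ (a , ≮⇒≥ ¬d' , ≰⇒> ¬b))
  ...   | no _ | no ¬a | yes b | _ = inj₂ (inj₂ (inj₁ (≮⇒≥ ¬a , b)))
  ...   | no ¬a | no _ | no ¬b | _ = inj₂ (inj₂ (inj₂ (≮⇒≥ ¬a , ≰⇒≥ ¬b)))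

  -- A relation `g h = h' g'` whose two sides have the same commuting letters `ι g` and `ι h'` as
  -- W-component, in opposite orders, and act alike on subsets. It realizes one commutation of W
  -- inside the cactus group.
  record Exchange (g h h' g' : Gen n) : Set where
    field
      relation : ⟨ g ⟩ ∷ ⟨ h ⟩ ∷ [] ≈ ⟨ h' ⟩ ∷ ⟨ g' ⟩ ∷ []
      moveˡ    : σ g (ι h) ≡ ι h'
      moveʳ    : σ h' (ι g') ≡ ι g
      σσ       : ∀ s → σ g (σ h s) ≡ σ h' (σ g' s)
      commute  : ¬ ι g # ι h'
  open Exchange

  Exchange-sym : ∀ {g h h' g'} → Exchange g h h' g' → Exchange h' g' g h
  Exchange-sym e .relation = ≈-sym (relation e)
  Exchange-sym e .moveˡ = moveʳ e
  Exchange-sym e .moveʳ = moveˡ e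
  Exchange-sym e .σσ s = sym (σσ e s)
  Exchange-sym e .commute = commute e ∘ #-sym

  disjoint-inside : ∀ g h → Disjoint g h → ∀ i → inside (p h) (q h) (rev (p g) (q g) i) ≡ inside (p h) (q h) i
  disjoint-inside g h d i with rev (p g) (q g) i | rev-view (p g) (q g) i
  ... | _ | outer _ = refl
  ... | _ | inner i∈ eq = inside-cong (⊥-elim ∘ Disjoint⇒¬In {g} {h} d (complement-In eq i∈))
                                      (⊥-elim ∘ Disjoint⇒¬In {g} {h} d i∈)

  disjoint-rev : ∀ g h → Disjoint g h → ∀ i →
                 rev (p h) (q h) (rev (p g) (q g) i) ≡ rev (p g) (q g) (rev (p h) (q h) i)
  disjoint-rev g h d i with rev (p g) (q g) i in e₁ | rev-view (p g) (q g) i | rev (p h) (q h) i in e₂ | rev-view (p h) (q h) i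
  ... | _ | outer _ | _ | outer _ = trans e₂ (sym e₁)
  ... | _ | outer _ | _ | inner i∈ eq =
        trans e₂ (sym (rev-outer λ k∈ → Disjoint⇒¬In {g} {h} d k∈ (complement-In eq i∈)))
  ... | _ | inner i∈ eq | _ | outer _ = trans (rev-outer (Disjoint⇒¬In {g} {h} d (complement-In eq i∈))) (sym e₁)
  ... | _ | inner i∈ _ | _ | inner i∈' _ = contradiction i∈' (Disjoint⇒¬In {g} {h} d i∈)

  exchange-disjoint : ∀ g h → Disjoint g h → Exchange g h h g
  exchange-disjoint g h d .relation = j2 g h d
  exchange-disjoint g h d .moveˡ = σι≡ι g h h (disjoint-inside g h d)
  exchange-disjoint g h d .moveʳ = σι≡ι h g g (disjoint-inside h g ([ inj₂ , inj₁ ]′ d))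
  exchange-disjoint g h d .σσ = σσ≡σσ g h h g (disjoint-rev g h d)
  exchange-disjoint g h d .commute = Disjoint⇒¬# {g} {h} d

  exchange-nested : ∀ g h h' → h ⊑ g → p h' ≡ p g + q g ∸ q h → q h' ≡ p g + q g ∸ p h → Exchange g h h' g
  exchange-nested g h h' (a , b) e₁ e₂ = λ where
      .relation → j3 g h h' a b e₁ e₂
      .moveˡ → σι≡ι g h h' λ i → inside-cong mirror-In⁻ mirror-In
      .moveʳ → σι≡ι h' g g inside-outer
      .σσ → σσ≡σσ g h h' g mirror-rev
      .commute → ⊑⇒¬# {g} {h'} (proj₁ (mirror-⊆ (≤-refl , <⇒≤ (p<q h'))) , proj₂ (mirror-⊆ (<⇒≤ (p<q h') , ≤-refl)))
    where
    qh≤ : q h ≤ p g + q g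
    qh≤ = ≤-trans b (m≤n+m (q g) (p g))
    open Mirror {c' = p h'} {q h'} a b
      (trans (cong (_+ q h) e₁) (m∸n+n≡m qh≤))
      (trans (cong (_+ p h) e₂) (m∸n+n≡m (≤-trans (<⇒≤ (p<q h)) qh≤)))
    inside-outer : ∀ i → inside (p g) (q g) (rev (p h') (q h') i) ≡ inside (p g) (q g) i
    inside-outer i with rev (p h') (q h') i | rev-view (p h') (q h') i
    ... | _ | outer _ = refl
    ... | _ | inner i∈ eq = inside-cong (λ _ → mirror-⊆ i∈) (λ _ → mirror-⊆ (complement-In eq i∈))

  mirror : ∀ g h → h ⊑ g → Gen n
  mirror g h (a , b) = record
    { p = p g + q g ∸ q h
    ; q = p g + q g ∸ p h
    ; p<q = ∸-monoʳ-< (p<q h) (≤-trans b (m≤n+m (q g) (p g)))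
    ; q<n = ≤-<-trans (≤-trans (∸-monoʳ-≤ (p g + q g) a) (≤-reflexive (m+n∸m≡n (p g) (q g)))) (q<n g)
    }

  -- Here the letter arriving in front is prescribed: mirroring twice gives `h` back, so `j3`
  -- applied to its mirror image produces `h`.
  exchange-mirror : ∀ g h (n : h ⊑ g) → Exchange g (mirror g h n) h g
  exchange-mirror g h h⊑g@(a , b) = exchange-nested g (mirror g h h⊑g) h
    ( ≤-trans (≤-reflexive (sym (m+n∸n≡m (p g) (q g)))) (∸-monoʳ-≤ (p g + q g) b)
    , ≤-trans (∸-monoʳ-≤ (p g + q g) a) (≤-reflexive (m+n∸m≡n (p g) (q g))))
    (sym (m∸[m∸n]≡n (≤-trans (<⇒≤ (p<q h)) (≤-trans b (m≤n+m (q g) (p g))))))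
    (sym (m∸[m∸n]≡n (≤-trans b (m≤n+m (q g) (p g)))))

  -- Lifts a commutation: when `ι h'` may pass `ι g`, a suitable second generator `h` brings `h'` to
  -- the front. When `g` is nested in `h'`, the exchange is `j3` for `h'` read backwards.
  exchange : ∀ g h' → ¬ ι h' # ι g → ∃ λ h → ∃ λ g' → Exchange g h h' g'
  exchange g h' c with position g h'
  ... | inj₁ x = contradiction (#-sym (Crosses⇒# g h' x)) c
  ... | inj₂ (inj₁ d) = _ , _ , exchange-disjoint g h' d
  ... | inj₂ (inj₂ (inj₁ h'⊑g)) = _ , _ , exchange-mirror g h' h'⊑g
  ... | inj₂ (inj₂ (inj₂ g⊑h')) = _ , _ , Exchange-sym (exchange-mirror h' g g⊑h')

  map-σσ : ∀ {g h h' g'} → Exchange g h h' g' → ∀ w → map (σ g) (map (σ h) w) ≡ map (σ h') (map (σ g') w)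
  map-σσ e w = trans (sym (List.map-∘ w)) (trans (List.map-cong (σσ e) w) (List.map-∘ w))

  -- The action of J_n on traces

  act : Word n → List (Vec Bool n) → List (Vec Bool n)
  act [] z = z
  act ((g , _) ∷ w) z = push (ι g) (map (σ g) (act w z))

  act-++ : ∀ u v z → act (u ++ v) z ≡ act u (act v z)
  act-++ [] v z = refl
  act-++ ((g , _) ∷ u) v z = cong (push (ι g) ∘ map (σ g)) (act-++ u v z)

  act-∼ : ∀ u {z z'} → z ∼ z' → act u z ∼ act u z'
  act-∼ [] e = e
  act-∼ ((g , _) ∷ u) e = push-∼ (Sym.∼-map g (act-∼ u e))

  act-Reduced : ∀ u {z} → Reduced z → Reduced (act u z)
  act-Reduced [] ρ = ρ
  act-Reduced ((g , _) ∷ u) ρ = push-Reduced (Sym.Reduced-map g (act-Reduced u ρ))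

  act-involutive : ∀ g {z} → Reduced z → push (ι g) (map (σ g) (push (ι g) (map (σ g) z))) ∼ z
  act-involutive g {z} ρ = ∼-trans
    (∼-reflexive (cong (push (ι g)) (trans (Sym.push-map g (ι g) (map (σ g) z))
                                           (cong₂ push (σι≡ι-self g) (Sym.map-involutive g z)))))
    (push-involutive ρ)

  act-exchange : ∀ {g h h' g'} → Exchange g h h' g' → ∀ z →
                 act (⟨ g ⟩ ∷ ⟨ h ⟩ ∷ []) z ∼ act (⟨ h' ⟩ ∷ ⟨ g' ⟩ ∷ []) z
  act-exchange {g} {h} {h'} {g'} e z =
    ∼-trans (∼-reflexive (cong (push (ι g)) (trans (Sym.push-map g (ι h) (map (σ h) z)) (cong₂ push (moveˡ e) (map-σσ e z)))))
   (∼-trans (push-comm (map (σ h') (map (σ g') z)) (commute e))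
            (∼-reflexive (cong (push (ι h')) (sym (trans (Sym.push-map h' (ι g') (map (σ g') z))
                                                         (cong (λ s → push s (map (σ h') (map (σ g') z))) (moveʳ e)))))))

  -- Reducedness of `z` enters through `free` and `j1`, where pushing a letter twice must restore
  -- the trace.
  act-≈ : ∀ {u v} → u ≈ v → ∀ {z} → Reduced z → act u z ∼ act v z
  act-≈ ≈-refl ρ = ∼-refl
  act-≈ (≈-sym e) ρ = ∼-sym (act-≈ e ρ)
  act-≈ (≈-trans e f) ρ = ∼-trans (act-≈ e ρ) (act-≈ f ρ)
  act-≈ (≈-cong {u} {u'} {v} {v'} e f) {z} ρ =
    ∼-trans (∼-reflexive (act-++ u v z))
   (∼-trans (act-∼ u (act-≈ f ρ))
   (∼-trans (act-≈ e (act-Reduced v' ρ))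
            (∼-reflexive (sym (act-++ u' v' z)))))
  act-≈ (free g _) ρ = act-involutive g ρ
  act-≈ (j1 g) ρ = act-involutive g ρ
  act-≈ (j2 g h d) {z} ρ = act-exchange (exchange-disjoint g h d) z
  act-≈ (j3 g h h' a b e f) {z} ρ = act-exchange (exchange-nested g h h' (a , b) e f) z

  -- Lifting the W-component back to the cactus group

  ⟪_⟫ : List (Gen n) → Word n
  ⟪_⟫ = map ⟨_⟩

  -- The W-component of a word before any cancellation: each interval is moved by the reversals to
  -- its left.
  trace : List (Gen n) → List (Vec Bool n)
  trace [] = []
  trace (g ∷ us) = ι g ∷ map (σ g) (trace us)

  trace-length : ∀ us → length (trace us) ≡ length us
  trace-length [] = refl
  trace-length (g ∷ us) = cong suc (trans (List.length-map (σ g) (trace us)) (trace-length us))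

  act-trace : ∀ us → act ⟪ us ⟫ [] ≡ nf (trace us)
  act-trace [] = refl
  act-trace (g ∷ us) = cong (push (ι g)) (trans (cong (map (σ g)) (act-trace us)) (Sym.nf-map g (trace us)))

  trace-++ : ∀ us vs → ∃ λ z → trace (us ++ vs) ≡ trace us ++ z
  trace-++ [] vs = _ , refl
  trace-++ (g ∷ us) vs with trace-++ us vs
  ... | z , eq = map (σ g) z , cong (ι g ∷_) (trans (cong (map (σ g)) eq) (List.map-++ (σ g) (trace us) z))

  First-trace-++ : ∀ {s} us vs → First s (trace us) → First s (trace (us ++ vs))
  First-trace-++ {s} us vs (_ , r) with trace-++ us vs
  ... | z , eq = subst (First s) (sym eq) (_ , Rem-++ z r)

  First-σ⁻ : ∀ g {w} → First (ι g) (map (σ g) w) → First (ι g) w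
  First-σ⁻ g {w} = Sym.First-map⁻ g ∘ subst (λ s → First s (map (σ g) w)) (sym (σι≡ι-self g))

  ≈-prep : ∀ l {u v : Word n} → u ≈ v → l ∷ u ≈ l ∷ v
  ≈-prep l e = ≈-cong (≈-refl {u = l ∷ []}) e

  -- Each letter that `ι h` passes on its way to the front is passed in the cactus group by an
  -- exchange. The separate `s` keeps the index a variable, so that `Rem` can be matched on.
  pull : ∀ {s} h us {v} → s ≡ ι h → Rem s (trace us) v →
         ∃ λ us' → ⟪ us ⟫ ≈ ⟪ h ∷ us' ⟫ × v ≡ map (σ h) (trace us')
  pull h (g ∷ us) eq here with ι-injective {g} {h} eq
  ... | refl = us , ≈-refl , refl
  pull h (g ∷ us) refl (there _ c r) with exchange g h c
  -- The tail of the trace is twisted by `σ g`; untwisting turns `ι h` into `ι k`, which is pulled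
  -- out of `us` first. Then `g k` becomes `h g'`.
  ... | k , g' , e with pull k us (trans (cong (σ g) (sym (moveˡ e))) (σ-involutive g (ι k))) (Sym.Rem-map⁻ g r)
  ...   | us' , us≈ , eq = g' ∷ us'
          , ≈-trans (≈-prep ⟨ g ⟩ us≈) (≈-cong (relation e) ≈-refl)
          , cong₂ _∷_ (sym (moveʳ e))
                  (trans (sym (Sym.map-involutive g _)) (trans (cong (map (σ g)) eq) (map-σσ e (trace us'))))

  letter-≈ : ∀ g b → (g , b) ∷ [] ≈ ⟨ g ⟩ ∷ []
  letter-≈ g true = ≈-refl
  letter-≈ g false = ≈-trans (≈-prep (g , false) (≈-sym (j1 g))) (≈-cong (free g false) ≈-refl)

  reduce : ∀ w → ∃ λ us → w ≈ ⟪ us ⟫ × Reduced (trace us)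
  reduce [] = [] , ≈-refl , []
  reduce ((g , b) ∷ w) with reduce w
  ... | us , w≈ , ρ with first? (ι g) (map (σ g) (trace us))
  ...   | no ν = g ∷ us , ≈-cong (letter-≈ g b) w≈ , ν ∷ Sym.Reduced-map g ρ
  -- `σ g` fixes `ι g`, so `g` can be pulled to the front of `us` and cancelled by `j1`.
  ...   | yes f with First-σ⁻ g f
  ...     | v , r with pull g us refl r
  ...       | us' , us≈ , refl = us'
            , ≈-trans (≈-cong (letter-≈ g b) (≈-trans w≈ us≈)) (≈-cong (j1 g) ≈-refl)
            , subst Reduced (Sym.map-involutive g (trace us')) (Sym.Reduced-map g (Reduced-tail (Reduced-Rem ρ r)))

  -- Paths of crossing intervals

  data Path : Gen n → List (Gen n) → Gen n → Set where
    [_] : ∀ {g h} → Crosses g h → Path g [] h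
    _∷_ : ∀ {g h k xs} → Crosses g h → Path h xs k → Path g (h ∷ xs) k

  -- If `ι g` could cancel, it would be a first letter beside `ι h`, but first letters commute.
  crosses-Reduced : ∀ g h us → Crosses g h → First (ι h) (trace us) → Reduced (trace us) → Reduced (trace (g ∷ us))
  crosses-Reduced g h us x f ρ = ν ∷ Sym.Reduced-map g ρ
    where
    ν : ¬ First (ι g) (map (σ g) (trace us))
    ν f' = firsts-commute (First-σ⁻ g f') f
             (λ eq → #-irrefl (subst (_# ι h) eq (Crosses⇒# g h x))) (Crosses⇒# g h x)

  -- The interior vertices `xs` are prepended from right to left, each crossing a first letter of
  -- what follows. The endpoint `g` is not prepended; it crosses the resulting first letter `ι k`.
  path-Reduced : ∀ {g xs h} us → Path g xs h → First (ι h) (trace us) → Reduced (trace us) →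
                 Reduced (trace (xs ++ us)) × ∃ λ k → Crosses g k × First (ι k) (trace (xs ++ us))
  path-Reduced {h = h} us [ x ] f ρ = ρ , h , x , f
  path-Reduced us (_∷_ {h = h} {xs = xs} x π) f ρ with path-Reduced us π f ρ
  ... | ρ' , k , y , f' = crosses-Reduced h k (xs ++ us) y f' ρ' , h , x , (_ , here)

  -- Since xs ++ us is reduced, the equally long word vs is reduced too, so that
  -- both sides are the same trace; but first letters of a trace never cross.
  path-clash : ∀ {g xs h} us vs → Path g xs h → First (ι h) (trace us) → Reduced (trace us) →
               First (ι g) (trace vs) → length vs ≡ length (xs ++ us) → ¬ ⟪ vs ⟫ ≈ ⟪ xs ++ us ⟫
  path-clash {g} {xs} us vs π f ρ f' len e with path-Reduced us π f ρ
  ... | ρ' , k , x , f″ = firsts-commute f' (First-∼ vs∼ f″)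
          (λ eq → #-irrefl (subst (_# ι k) eq (Crosses⇒# g k x))) (Crosses⇒# g k x)
    where
    nf∼ : nf (trace vs) ∼ trace (xs ++ us)
    nf∼ = ∼-trans (∼-reflexive (sym (act-trace vs)))
         (∼-trans (act-≈ e [])
                  (∼-reflexive (trans (act-trace (xs ++ us)) (Reduced⇒nf≡ ρ'))))
    vs-Reduced : Reduced (trace vs)
    vs-Reduced = nf-length⇒Reduced (trace vs)
      (trans (∼-length nf∼) (trans (trace-length (xs ++ us)) (trans (sym len) (sym (trace-length vs)))))
    vs∼ : trace (xs ++ us) ∼ trace vs
    vs∼ = ∼-trans (∼-sym nf∼) (∼-reflexive (Reduced⇒nf≡ vs-Reduced))

-- Pure paths

perm-++ : ∀ {n} (u v : Word n) i → perm (u ++ v) i ≡ perm u (perm v i)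
perm-++ [] v i = refl
perm-++ ((g , _) ∷ u) v i = cong (rev (p g) (q g)) (perm-++ u v i)

crosses? : ∀ {n} (g h : Gen n) → Dec (Crosses g h)
crosses? g h = overlaps? g h ⊎-dec overlaps? h g
  where
  overlaps? : ∀ g h → Dec (Overlaps g h)
  overlaps? g h = p g <? p h ×-dec p h ≤? q g ×-dec q g <? q h

path? : ∀ {n} (g : Gen n) xs h → Dec (Path g xs h)
path? g [] h = map′ [_] (λ { [ x ] → x }) (crosses? g h)
path? g (k ∷ xs) h = map′ (λ (x , π) → x ∷ π) (λ { (x ∷ π) → x , π }) (crosses? g k ×-dec path? k xs h)

module _ {n : ℕ} (a : ℕ) (a+4≤n : a + 4 ≤ n) where

  shift : Gen 4 → Gen n
  shift g = gen (a + p g) (a + q g) (+-monoʳ-< a (p<q g)) (<-≤-trans (+-monoʳ-< a (q<n g)) a+4≤n)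

  perm-shift : ∀ xs c → perm ⟪ map shift xs ⟫ (a + c) ≡ a + perm ⟪ xs ⟫ c
  perm-shift [] c = refl
  perm-shift (g ∷ xs) c = trans (cong (rev (a + p g) _) (perm-shift xs c)) (rev-shift a (p g) (q g) (perm ⟪ xs ⟫ c))

  perm-shift-< : ∀ xs {i} → i < a → perm ⟪ map shift xs ⟫ i ≡ i
  perm-shift-< [] i<a = refl
  perm-shift-< (g ∷ xs) i<a = trans (cong (rev (a + p g) _) (perm-shift-< xs i<a))
    (rev-outer (<⇒≱ i<a ∘ ≤-trans (m≤m+n a (p g)) ∘ proj₁))

  -- The hypothesis covers every `c`, so positions to the right of the block are treated by the same
  -- translation as those inside it.
  shift-pure : ∀ xs → (∀ c → perm ⟪ xs ⟫ c ≡ c) → Pure ⟪ map shift xs ⟫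
  shift-pure xs pure i _ with i <? a
  ... | yes i<a = perm-shift-< xs i<a
  ... | no i≮a = subst (λ j → perm ⟪ map shift xs ⟫ j ≡ j) (m+[n∸m]≡n (≮⇒≥ i≮a))
                   (trans (perm-shift xs (i ∸ a)) (cong (a +_) (pure (i ∸ a))))

  shift-crosses : ∀ {g h} → Crosses g h → Crosses (shift g) (shift h)
  shift-crosses (inj₁ (x , y , z)) = inj₁ (+-monoʳ-< a x , +-monoʳ-≤ a y , +-monoʳ-< a z)
  shift-crosses (inj₂ (x , y , z)) = inj₂ (+-monoʳ-< a x , +-monoʳ-≤ a y , +-monoʳ-< a z)

  -- s meets the block [a, a+3] in the interval b
  record Restricts (s : Gen n) (b : Gen 4) : Set where
    field
      p≤ : p s ≤ a + p b
      q≥ : a + q b ≤ q s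
      p≥ : 0 < p b → a + p b ≤ p s
      q≤ : q b < 3 → q s ≤ a + q b

  -- Where `h` reaches beyond an end of `b`, that end is away from the border of the block, and
  -- there the ends of `s` and `b` agree.
  restricts-crosses : ∀ {s b} → Restricts s b → ∀ h → Crosses b h → Crosses s (shift h)
  restricts-crosses r h (inj₁ (x , y , z)) = inj₁
    ( ≤-<-trans p≤ (+-monoʳ-< a x)
    , ≤-trans (+-monoʳ-≤ a y) q≥
    , ≤-<-trans (q≤ (<-≤-trans z (≤-pred (q<n h)))) (+-monoʳ-< a z))
    where open Restricts r
  restricts-crosses r h (inj₂ (x , y , z)) = inj₂
    ( <-≤-trans (+-monoʳ-< a x) (p≥ (≤-<-trans z≤n x))
    , ≤-trans p≤ (+-monoʳ-≤ a y)
    , <-≤-trans (+-monoʳ-< a z) q≥)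
    where open Restricts r

  shift-path : ∀ {s b} → Restricts s b → ∀ {g h xs} → Crosses g h → Path h xs b → Path (shift g) (map shift (h ∷ xs)) s
  shift-path {s} {b} r {g} {h} x [ y ] =
    shift-crosses {g} {h} x ∷ [ Crosses-sym s (shift h) (restricts-crosses r h (Crosses-sym h b y)) ]
  shift-path r {g} {h} x (y ∷ π) = shift-crosses {g} {h} x ∷ shift-path r y π

  -- Only the two outermost steps involve `s`; all others stay inside the block and are translated.
  restricts-path : ∀ {s b} → Restricts s b → ∀ {h k xs} → Path b (h ∷ k ∷ xs) b → Path s (map shift (h ∷ k ∷ xs)) s
  restricts-path r {h} (x ∷ y ∷ π) = restricts-crosses r h x ∷ shift-path r y π

-- named by the paper's 1-indexed positions
s12 s23 s34 s13 s24 : Gen 4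
s12 = gen 0 1 (toWitness {a? = 0 <? 1} tt) (toWitness {a? = 1 <? 4} tt)
s23 = gen 1 2 (toWitness {a? = 1 <? 2} tt) (toWitness {a? = 2 <? 4} tt)
s34 = gen 2 3 (toWitness {a? = 2 <? 3} tt) (toWitness {a? = 3 <? 4} tt)
s13 = gen 0 2 (toWitness {a? = 0 <? 2} tt) (toWitness {a? = 2 <? 4} tt)
s24 = gen 1 3 (toWitness {a? = 1 <? 3} tt) (toWitness {a? = 3 <? 4} tt)

PureLoop : ∀ {n} → Gen n → Set
PureLoop s = ∃ λ xs → Path s xs s × Pure ⟪ xs ⟫

square cube : Gen 4 → Gen 4 → List (Gen 4)
square g h = g ∷ h ∷ g ∷ h ∷ []
cube g h = g ∷ h ∷ square g h

block-loop : ∀ {n} a (a+4≤n : a + 4 ≤ n) {s b} → Restricts a a+4≤n s b → ∀ h k xs →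
             {True (path? b (h ∷ k ∷ xs) b)} → (∀ c → perm ⟪ h ∷ k ∷ xs ⟫ c ≡ c) → PureLoop s
block-loop a a+4≤n r h k xs {π} pure =
  map (shift a a+4≤n) (h ∷ k ∷ xs) , restricts-path a a+4≤n r (toWitness π) , shift-pure a a+4≤n (h ∷ k ∷ xs) pure

-- In this and the next four loops every generator reverses two or three positions, hence acts as a
-- transposition. Two transpositions sharing a point have a product of order 3, while `s13` and
-- `s24` act disjointly and have a product of order 2. The two leading letters complete the first
-- square to a cube.
loop12 : ∀ {n} a (l : a + 4 ≤ n) {s} → Restricts a l s s12 → PureLoop s
loop12 a l r = block-loop a l r s23 s34 (square s23 s34 ++ square s13 s24)
  λ { 0 → refl ; 1 → refl ; 2 → refl ; 3 → refl ; (suc (suc (suc (suc _)))) → refl }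

loop23 : ∀ {n} a (l : a + 4 ≤ n) {s} → Restricts a l s s23 → PureLoop s
loop23 a l r = block-loop a l r s12 s24 (square s12 s24 ++ cube s13 s34)
  λ { 0 → refl ; 1 → refl ; 2 → refl ; 3 → refl ; (suc (suc (suc (suc _)))) → refl }

loop34 : ∀ {n} a (l : a + 4 ≤ n) {s} → Restricts a l s s34 → PureLoop s
loop34 a l r = block-loop a l r s23 s12 (square s23 s12 ++ square s24 s13)
  λ { 0 → refl ; 1 → refl ; 2 → refl ; 3 → refl ; (suc (suc (suc (suc _)))) → refl }

loop13 : ∀ {n} a (l : a + 4 ≤ n) {s} → Restricts a l s s13 → PureLoop s
loop13 a l r = block-loop a l r s34 s23 (square s34 s23 ++ cube s12 s24)
  λ { 0 → refl ; 1 → refl ; 2 → refl ; 3 → refl ; (suc (suc (suc (suc _)))) → refl }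

loop24 : ∀ {n} a (l : a + 4 ≤ n) {s} → Restricts a l s s24 → PureLoop s
loop24 a l r = block-loop a l r s12 s23 (square s12 s23 ++ cube s34 s13)
  λ { 0 → refl ; 1 → refl ; 2 → refl ; 3 → refl ; (suc (suc (suc (suc _)))) → refl }

-- Pure loops at every proper interval

Proper : ∀ {n} → Gen n → Set
Proper {n} s = 0 < p s ⊎ suc (q s) < n

proper? : ∀ {n} (s : Gen n) → Dec (Proper s)
proper? {n} s = 0 <? p s ⊎-dec suc (q s) <? n

¬proper-p : ∀ {n} (s : Gen n) → ¬ Proper s → p s ≡ 0
¬proper-p s ¬proper = n≤0⇒n≡0 (≮⇒≥ (¬proper ∘ inj₁))

¬proper-q : ∀ {n} (s : Gen n) → ¬ Proper s → suc (q s) ≡ n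
¬proper-q s ¬proper = ≤-antisym (q<n s) (≮⇒≥ (¬proper ∘ inj₂))

-- The block is placed around an end of `s` that is not an end of the whole range, the right one if
-- possible. It then meets `s` in one of the five shapes above.
pure-loop : ∀ {n} → 3 < n → (s : Gen n) → Proper s → PureLoop s
pure-loop {n} 3<n s proper with suc (q s) <? n
pure-loop 3<n (gen zero 1 _ _) _ | yes _ = loop12 0 3<n
  record { p≤ = ≤-refl ; q≥ = ≤-refl ; p≥ = λ () ; q≤ = λ _ → ≤-refl }
pure-loop 3<n (gen (suc _) 1 (s≤s ()) _) _ | yes _
-- The block starts at `a`, so `s` ends at its third position. Either `s` covers the first position,
-- or it consists of the second and third.
pure-loop {n} 3<n (gen c (suc (suc a)) c<q _) _ | yes q+1<n with c ≤? a
... | yes c≤a = loop13 a (subst (_≤ n) (+-comm 4 a) q+1<n) record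
        { p≤ = ≤-trans c≤a (m≤m+n a 0)
        ; q≥ = ≤-reflexive (+-comm a 2)
        ; p≥ = λ ()
        ; q≤ = λ _ → ≤-reflexive (+-comm 2 a) }
... | no c≰a = loop23 a (subst (_≤ n) (+-comm 4 a) q+1<n) record
        { p≤ = ≤-trans (≤-pred c<q) (≤-reflexive (+-comm 1 a))
        ; q≥ = ≤-reflexive (+-comm a 2)
        ; p≥ = λ _ → ≤-trans (≤-reflexive (+-comm a 1)) (≰⇒> c≰a)
        ; q≤ = λ _ → ≤-reflexive (+-comm 2 a) }
pure-loop 3<n (gen zero _ _ _) (inj₂ q+1<n) | no q+1≮n = contradiction q+1<n q+1≮n
-- Now `s` reaches the right end of the range, and the block starts just left of `s`, provided `s`
-- has at least three positions.
pure-loop {n} 3<n (gen (suc a) d p<q d<n) _ | no d+1≮n with 3 + a ≤? d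
... | yes 3+a≤d = loop24 a (subst (_≤ n) (+-comm 4 a) (≤-trans (s≤s 3+a≤d) d<n)) record
        { p≤ = ≤-reflexive (+-comm 1 a)
        ; q≥ = ≤-trans (≤-reflexive (+-comm a 3)) 3+a≤d
        ; p≥ = λ _ → ≤-reflexive (+-comm a 1)
        ; q≤ = λ 3<3 → contradiction 3<3 (<-irrefl refl) }
pure-loop 3<n (gen 1 d p<q d<n) _ | no d+1≮n | no 3≰d =
  contradiction (≤-trans 3<n (≤-trans (≮⇒≥ d+1≮n) (≰⇒> 3≰d))) (<-irrefl refl)
-- With only two positions left in `s`, the block consists of the last four positions of the range.
pure-loop {n} 3<n (gen (suc (suc a)) d p<q d<n) _ | no _ | no _ =
  loop34 a (subst (_≤ n) (+-comm 4 a) (≤-trans (s≤s p<q) d<n)) record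
        { p≤ = ≤-reflexive (+-comm 2 a)
        ; q≥ = ≤-trans (≤-reflexive (+-comm a 3)) p<q
        ; p≥ = λ _ → ≤-reflexive (+-comm a 2)
        ; q≤ = λ 3<3 → contradiction 3<3 (<-irrefl refl) }

-- Words commuting with all pure words

CommutesWithPure : ∀ {n} → List (Gen n) → Set
CommutesWithPure us = ∀ xs → Pure ⟪ xs ⟫ → ⟪ us ++ xs ⟫ ≈ ⟪ xs ++ us ⟫

proper-first-clash : ∀ {n} → 3 < n → ∀ (s : Gen n) us → Proper s → First (ι s) (trace us) →
                     Reduced (trace us) → ¬ CommutesWithPure us
proper-first-clash 3<n s us proper f ρ comm with pure-loop 3<n s proper
... | xs , π , pure = path-clash us (us ++ xs) π f ρ (First-trace-++ us xs f) (List.length-++-comm us xs) (comm xs pure)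

-- The second letter of this trace is `ι h'` by `moveˡ`, and it commutes past `ι g`.
First-second : ∀ {n} (g h h' : Gen n) us → Exchange g h h' g → h' ≢ g → First (ι h') (trace (g ∷ h ∷ us))
First-second g h h' us e h'≢g = subst (λ s → First (ι h') (ι g ∷ s ∷ map (σ g) (map (σ h) (trace us)))) (sym (moveˡ e))
  (_ , there (h'≢g ∘ ι-injective) (commute e ∘ #-sym) here)
  where open Exchange

mirror-proper : ∀ {n} (g h : Gen n) (h⊑g : h ⊑ g) → ¬ Proper g → Proper h → Proper (mirror g h h⊑g)
mirror-proper {n} g h (_ , _) full proper with ¬proper-p g full | ¬proper-q g full
mirror-proper (gen zero b _ _) h (_ , qh≤) full (inj₁ 0<ph) | refl | refl =
  inj₂ (s≤s (∸-monoʳ-< 0<ph (≤-trans (<⇒≤ (p<q h)) qh≤)))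
mirror-proper (gen zero b _ _) h _ full (inj₂ qh<) | refl | refl = inj₁ (m<n⇒0<n∸m (≤-pred qh<))

full-⊒ : ∀ {n} (g : Gen n) → ¬ Proper g → ∀ h → h ⊑ g
full-⊒ g full h =
  subst (_≤ p h) (sym (¬proper-p g full)) z≤n , ≤-pred (subst (q h <_) (sym (¬proper-q g full)) (q<n h))

-- Conjugation by s_{1,n} moves [1, n−1] to [2, n], which crosses it.
full-clash : ∀ {n} → 3 < n → ∀ (g : Gen n) → ¬ Proper g → ¬ CommutesWithPure (g ∷ [])
full-clash 3<n g@(gen _ (suc m) _ _) full comm with ¬proper-p g full | ¬proper-q g full
-- The pure word is `t ys t`, where `ys` is a pure loop at `t`. In `t ys t g` the letters `t ys`
-- form the interior of a path from `u` to `t`, whereas `g t ys t` has the first letter `ι u`.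
... | refl | refl = path-clash {g = u} (t ∷ g ∷ []) (g ∷ t ∷ ys ++ t ∷ []) (inj₂ (z<s , 0<m , ≤-refl) ∷ π) (_ , here) ρ
        (First-second g t u (ys ++ t ∷ []) g-t-u λ ()) len
        (subst (λ us → ⟪ g ∷ t ∷ ys ++ t ∷ [] ⟫ ≈ ⟪ t ∷ us ⟫) (List.++-assoc ys (t ∷ []) (g ∷ []))
          (comm (t ∷ ys ++ t ∷ []) xs-pure))
  where
  0<m : 0 < m
  0<m = ≤-trans (s≤s z≤n) (≤-pred (≤-pred 3<n))
  t u : Gen (suc (suc m))
  t = gen 0 m 0<m (n≤1+n _)
  u = gen 1 (suc m) (s≤s 0<m) ≤-refl
  loop : PureLoop t
  loop = pure-loop 3<n t (inj₂ ≤-refl)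
  ys = proj₁ loop
  π = proj₁ (proj₂ loop)
  g-t-u : Exchange g t u g
  g-t-u = exchange-nested g t u (z≤n , n≤1+n m) (sym (m+n∸n≡m 1 m)) refl
  ν : ¬ First (ι t) (map (σ t) (trace (g ∷ [])))
  ν f = [ (λ eq → 1+n≢n (sym (cong q (ι-injective {g = t} {g} eq)))) , (λ ()) ]′ (First-∷⁻ (First-σ⁻ t {trace (g ∷ [])} f))
  ρ : Reduced (trace (t ∷ g ∷ []))
  ρ = ν ∷ Sym.Reduced-map t {trace (g ∷ [])} ((λ ()) ∷ [])
  len : length (g ∷ t ∷ ys ++ t ∷ []) ≡ length (t ∷ ys ++ t ∷ g ∷ [])
  len = cong suc (trans (cong suc (List.length-++ ys)) (trans (sym (+-suc (length ys) 1)) (sym (List.length-++ ys))))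
  xs-pure : Pure ⟪ t ∷ ys ++ t ∷ [] ⟫
  xs-pure i i<n = trans (cong (rev 0 m)
    (trans (cong (λ w → perm w i) (List.map-++ ⟨_⟩ ys (t ∷ [])))
    (trans (perm-++ ⟪ ys ⟫ ⟪ t ∷ [] ⟫ i) (proj₂ (proj₂ loop) (rev 0 m i) (rev-< {0} (q<n t) i<n)))))
    (rev-involutive 0 m i)

reduced-clash : ∀ {n} → 3 < n → ∀ (g : Gen n) us → Reduced (trace (g ∷ us)) → ¬ CommutesWithPure (g ∷ us)
reduced-clash 3<n g us ρ comm with proper? g
... | yes proper = proper-first-clash 3<n g (g ∷ us) proper (_ , here) ρ comm
reduced-clash 3<n g [] ρ comm | no full = full-clash 3<n g full comm
reduced-clash 3<n g (h ∷ us) ρ@(ν ∷ _) comm | no full with proper? h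
-- Two full intervals are equal, so the first two letters would cancel.
... | no full' = ν (_ , subst (λ s → Rem s (map (σ g) (trace (h ∷ us))) (map (σ g) (map (σ h) (trace us))))
                              (trans (cong (σ g ∘ ι) h≡g) (σι≡ι-self g)) here)
  where
  h≡g : h ≡ g
  h≡g = Gen-≡ (trans (¬proper-p h full') (sym (¬proper-p g full)))
              (suc-injective (trans (¬proper-q h full') (sym (¬proper-q g full))))
-- `g` is full, so `h` passes to the front as its mirror image, which is again proper.
... | yes proper = proper-first-clash 3<n h' (g ∷ h ∷ us) proper'
        (First-second g h h' us (exchange-nested g h h' h⊑g refl refl) λ h'≡g → full (subst Proper h'≡g proper')) ρ comm
  where
  h⊑g = full-⊒ g full h
  h' = mirror g h h⊑g
  proper' : Proper h'
  proper' = mirror-proper g h h⊑g full proper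

theorem4p2 : (n : ℕ) → 3 < n → (w : Word n) →
    ((x : Word n) → Pure x → w ++ x ≈ x ++ w) → w ≈ []
theorem4p2 n 3<n w comm with reduce w
... | [] , w≈ , _ = w≈
... | g ∷ us , w≈ , ρ = ⊥-elim (reduced-clash 3<n g us ρ λ xs pure →
        subst₂ _≈_ (sym (List.map-++ ⟨_⟩ (g ∷ us) xs)) (sym (List.map-++ ⟨_⟩ xs (g ∷ us)))
          (≈-trans (≈-cong (≈-sym w≈) ≈-refl)
          (≈-trans (comm ⟪ xs ⟫ pure) (≈-cong (≈-refl {u = ⟪ xs ⟫}) w≈))))
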